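{- If there exists a deterministic one-pass catalytic streaming algorithm using $s$ bits of clean space (together with some number $c$ of bits of catalytic space), then there exists a deterministic one-pass (non-catalytic) streaming algorithm using $s$ bits of space that gives the same output as the catalytic streaming algorithm on every input stream.
   Context: Let $\Omega$ be the universe of stream items and $\mathcal O$ the output space. Space means storage space: the memory maintained between arrivals of consecutive items; the memory used while processing a single item is not counted. Accordingly, one-pass streaming algorithms are modelled by automata, as follows. A deterministic one-pass streaming algorithm with $s$ bits of space is a tuple $(Q,q_0,\Omega,\delta,O)$ with $|Q|=2^s$ ($Q$ is the set of memory configurations), start state $q_0\in Q$, transition function $\delta:Q\times\Omega\to Q$ and output function $O:Q\to\mathcal O$. Extend $\delta$ to $\Delta:Q\times\Omega^*\to Q$ by $\Delta(q,\varepsilon)=q$ (for the empty stream $\varepsilon$) and $\Delta(q,x\omega)=\delta(\Delta(q,x),\omega)$. The output on a stream $\mathcal S\in\Omega^*$ is $O(\Delta(q_0,\mathcal S))$. A deterministic one-pass catalytic streaming algorithm with $s$ bits of clean space and $c$ bits of catalytic space is a tuple $(Q\times C,q_0,\Omega,\delta,O)$ with $|Q|=2^s$, $|C|=2^c$, $q_0\in Q$, $\delta:(Q\times C)\times\Omega\to Q\times C$ and $O:Q\times C\to\mathcal O\times C$, such that for every stream $\mathcal S\in\Omega^*$ and every initial catalytic state $y\in C$, $O(\Delta((q_0,y),\mathcal S))\in\mathcal O\times\{y\}$ (the catalytic state is restored), where $\Delta:(Q\times C)\times\Omega^*\to Q\times C$ is the extension of $\delta$ to streams defined by $\Delta((q,z),\varepsilon)=(q,z)$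 and $\Delta((q,z),x\omega)=\delta(\Delta((q,z),x),\omega)$ for $(q,z)\in Q\times C$, $x\in\Omega^*$, $\omega\in\Omega$. The output of the catalytic algorithm on $\mathcal S$ is the $\mathcal O$-component of $O(\Delta((q_0,y),\mathcal S))$, which is required to be the same for every initial catalytic state $y$. -}

module Defs where

open import Data.Fin.Base using (Fin)
open import Data.List.Base using (List; []; _∷ʳ_; foldl)
open import Data.List.Properties using (foldl-∷ʳ)
open import Data.Nat.Base using (ℕ; _^_)
open import Data.Product.Base using (_×_; _,_; proj₁; proj₂)
open import Function.Bundles using (_↔_)
open import Level using (Level; 0ℓ; _⊔_) renaming (suc to lsuc)
open import Relation.Binary.PropositionalEquality using (_≡_; refl)

private
  variable
    a b q : Level

-- The head of the list is the item that arrives first.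
Stream : Set a → Set a
Stream Ω = List Ω

module _ {State : Set q} {Ω : Set a} (δ : State → Ω → State) where

  Δ : State → Stream Ω → State
  Δ = foldl δ

  Δ-[] : ∀ p → Δ p [] ≡ p
  Δ-[] p = refl

  Δ-∷ʳ : ∀ p x ω → Δ p (x ∷ʳ ω) ≡ δ (Δ p x) ω
  Δ-∷ʳ p x ω = foldl-∷ʳ δ p ω x

record StreamingAlgorithm (Ω : Set a) (𝒪 : Set b) (s : ℕ) : Set (lsuc 0ℓ ⊔ a ⊔ b) where
  field
    Q   : Set
    ∣Q∣ : Q ↔ Fin (2 ^ s)
    q₀  : Q
    δ   : Q → Ω → Q
    O   : Q → 𝒪

  output : Stream Ω → 𝒪
  output S = O (Δ δ q₀ S)

record CatalyticStreamingAlgorithm (Ω : Set a) (𝒪 : Set b) (s c : ℕ) : Set (lsuc 0ℓ ⊔ a ⊔ b) where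
  field
    Q   : Set
    C   : Set
    ∣Q∣ : Q ↔ Fin (2 ^ s)
    ∣C∣ : C ↔ Fin (2 ^ c)
    q₀  : Q
    δ   : Q × C → Ω → Q × C
    O   : Q × C → 𝒪 × C

  final : C → Stream Ω → 𝒪 × C
  final y S = O (Δ δ (q₀ , y) S)

  output : C → Stream Ω → 𝒪
  output y S = proj₁ (final y S)

  field
    restores    : ∀ S y → proj₂ (final y S) ≡ y
    independent : ∀ S y y′ → output y S ≡ output y′ S

{-# OPTIONS --safe #-}
-- Fix y ∈ C and let U y be the set of configurations whose output function
-- returns y.  Every configuration reachable from (q₀ , y) lies in U y, since the
-- algorithm may stop at any time and must then restore y.  The sets U y
-- partition the 2 ^ s * 2 ^ c configurations into 2 ^ c classes, so some U y has
-- at most 2 ^ s elements; a streaming algorithm with 2 ^ s states can simulate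
-- the catalytic one started in (q₀ , y).  Unlike reachability, membership in
-- U y is decidable, which keeps the argument constructive for arbitrary Ω.
module Submission where

open import Defs
open import Data.Fin.Base using (Fin; zero; suc; inject≤)
open import Data.Fin.Properties
  using (_≟_; any?; inject≤-injective; injective⇒≤; *↔×)
open import Data.List.Base using (List; []; _∷_; length; lookup; filter; allFin)
open import Data.List.Membership.Propositional using (_∈_)
open import Data.List.Membership.Propositional.Properties
  using (∈-lookup; ∈-filter⁺; ∈-filter⁻; ∈-allFin)
open import Data.List.Relation.Unary.All as All using ()
open import Data.List.Relation.Unary.AllPairs using (_∷_)
open import Data.List.Relation.Unary.Any using (here; there)
open import Data.List.Relation.Unary.Unique.Propositional using (Unique)
open import Data.List.Relation.Unary.Unique.Propositional.Properties using (allFin⁺; filter⁺)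
open import Data.Nat.Base using (ℕ; suc; _*_; _≤_; _^_; NonZero; s≤s)
open import Data.Nat.Properties using (_≤?_; ≰⇒>; <⇒≱; *-comm; *-monoˡ-<; m^n≢0; n<1+n)
open import Data.Product.Base using (Σ-syntax; ∃; _×_; _,_; proj₁; proj₂; map; map₂)
open import Data.Product.Function.NonDependent.Propositional using (_×-↔_)
import Data.Vec.Functional as Vector
open import Function.Base using (_∘_; id)
open import Function.Bundles using (Injection; Inverse)
open import Function.Definitions using (Injective)
open import Function.Properties.Inverse using (↔-refl; ↔-sym; ↔-trans; ↔⇒↣)
open import Level using (Level)
open import Relation.Binary.PropositionalEquality
  using (_≡_; refl; sym; trans; cong; subst)
open import Relation.Nullary using (yes; no; contradiction)

private
  variable
    a b : Level
    m n N : ℕ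

lookup-injective : {A : Set a} {xs : List A} → Unique xs → Injective _≡_ _≡_ (lookup xs)
lookup-injective (_   ∷ _) {zero}  {zero}  _  = refl
lookup-injective (x∉  ∷ _) {zero}  {suc j} eq = contradiction eq (All.lookup x∉ (∈-lookup j))
lookup-injective (x∉  ∷ _) {suc i} {zero}  eq = contradiction (sym eq) (All.lookup x∉ (∈-lookup i))
lookup-injective (_   ∷ u) {suc i} {suc j} eq = cong suc (lookup-injective u eq)

-- Indices beyond the length of `xs` all go to the default `d`; `dec` has to reach every entry and
-- may also take values outside `xs`.
enumerate : {A : Set a} (xs : List A) → length xs ≤ m → A →
            Σ[ dec ∈ (Fin m → A) ] (∀ {x} → x ∈ xs → ∃ λ j → dec j ≡ x)
enumerate []       _        d = (λ _ → d) , λ ()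
enumerate (x ∷ xs) (s≤s le) d with dec , covers ← enumerate xs le d =
  x Vector.∷ dec , λ where
    (here refl) → zero , refl
    (there x∈)  → map suc id (covers x∈)

fibre : (Fin N → Fin n) → Fin n → List (Fin N)
fibre f y = filter (λ i → f i ≟ y) (allFin _)

∈-fibre⁺ : (f : Fin N → Fin n) {i : Fin N} {y : Fin n} → f i ≡ y → i ∈ fibre f y
∈-fibre⁺ f {i} = ∈-filter⁺ (λ i → f i ≟ _) (∈-allFin i)

∈-fibre⁻ : (f : Fin N → Fin n) {i : Fin N} {y : Fin n} → i ∈ fibre f y → f i ≡ y
∈-fibre⁻ f = proj₂ ∘ ∈-filter⁻ (λ i → f i ≟ _) {xs = allFin _}

fibre-unique : (f : Fin N → Fin n) (y : Fin n) → Unique (fibre f y)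
fibre-unique f y = filter⁺ (λ i → f i ≟ y) (allFin⁺ _)

-- Sending `(y , j)` to the entry at position `j` of the fibre over `y` is injective: fibres are
-- disjoint and list no element twice.
large-fibres : (f : Fin N → Fin n) → (∀ y → m ≤ length (fibre f y)) → n * m ≤ N
large-fibres {N} {n} {m} f large = injective⇒≤ {f = λ k → member (proj₁ (split k)) (proj₂ (split k))} inj
  where
  open Inverse (*↔× {n} {m}) using () renaming (to to split)
  open Injection (↔⇒↣ (*↔× {n} {m})) using () renaming (injective to split-injective)

  member : Fin n → Fin m → Fin N
  member y j = lookup (fibre f y) (inject≤ j (large y))

  f-member : ∀ y j → f (member y j) ≡ y
  f-member y j = ∈-fibre⁻ f (∈-lookup {xs = fibre f y} _)

  member-injective : ∀ y y′ j j′ → member y j ≡ member y′ j′ → (y , j) ≡ (y′ , j′)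
  member-injective y y′ j j′ eq
    -- Applying `f` recovers the fibre, so both positions lie in the same list and can be compared.
    with refl ← trans (sym (f-member y j)) (trans (cong f eq) (f-member y′ j′)) =
    cong (y ,_) (inject≤-injective (large y) (large y) j j′ (lookup-injective (fibre-unique f y) eq))

  inj : Injective _≡_ _≡_ (λ k → member (proj₁ (split k)) (proj₂ (split k)))
  inj eq = split-injective (member-injective _ _ _ _ eq)

small-fibre : .{{_ : NonZero n}} (f : Fin (m * n) → Fin n) → ∃ λ y → length (fibre f y) ≤ m
small-fibre {n} {m} f with any? (λ y → length (fibre f y) ≤? m)
... | yes p = p
-- Otherwise every fibre has at least `suc m` elements, giving `suc m * n ≤ m * n`, which is absurd
-- for nonzero `n`.
... | no ¬p = contradiction
  (subst (_≤ m * n) (*-comm n (suc m)) (large-fibres f (λ y → ≰⇒> (λ le → ¬p (y , le)))))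
  (<⇒≱ (*-monoˡ-< n (n<1+n m)))

module _ {Ω : Set a} {𝒪 : Set b} {s c : ℕ} (A : CatalyticStreamingAlgorithm Ω 𝒪 s c) where

  open CatalyticStreamingAlgorithm A

  private
    instance
      2^c≢0 : NonZero (2 ^ c)
      2^c≢0 = m^n≢0 2 c

    open Inverse ∣C∣ using () renaming
      (to to codeC; from to decodeC; strictlyInverseˡ to codeC-decodeC)
    open Injection (↔⇒↣ ∣C∣) using () renaming (injective to codeC-injective)

    open Inverse (↔-trans (∣Q∣ ×-↔ ∣C∣) (↔-sym *↔×)) using () renaming
      (to to code; from to decode; strictlyInverseʳ to decode-code)

    -- Numbering configurations and catalytic states turns the classes `U y` into fibres of a map
    -- between finite sets.
    restored : Fin (2 ^ s * 2 ^ c) → Fin (2 ^ c)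
    restored = codeC ∘ proj₂ ∘ O ∘ decode

  small-restoring-class :
    Σ[ y ∈ C ] Σ[ dec ∈ (Fin (2 ^ s) → Q × C) ] (∀ p → proj₂ (O p) ≡ y → ∃ λ j → dec j ≡ p)
  small-restoring-class
    with k , small ← small-fibre {m = 2 ^ s} restored
    with dec , covers ← enumerate (fibre restored k) small (code (q₀ , decodeC k)) =
    decodeC k , decode ∘ dec , λ p eq →
      map₂ (λ eq′ → trans (cong decode eq′) (decode-code p))
        (covers (∈-fibre⁺ restored
          (trans (cong (codeC ∘ proj₂ ∘ O) (decode-code p))
            (trans (cong codeC eq) (codeC-decodeC k)))))

  module Simulation (y : C) (dec : Fin (2 ^ s) → Q × C)
                    (covers : ∀ p → proj₂ (O p) ≡ y → ∃ λ j → dec j ≡ p) where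

    start : ∃ λ j → dec j ≡ (q₀ , y)
    start = covers (q₀ , y) (restores [] y)

    -- Configurations that do not restore y are sent to the junk value
    -- proj₁ start; they never occur in a run from (q₀ , y).
    enc : Q × C → Fin (2 ^ s)
    enc p with codeC (proj₂ (O p)) ≟ codeC y
    ... | yes eq = proj₁ (covers p (codeC-injective eq))
    ... | no  _  = proj₁ start

    -- Membership in the class of `y` rules out the junk branch of `enc`.
    dec-enc : ∀ p → proj₂ (O p) ≡ y → dec (enc p) ≡ p
    dec-enc p p∈ with codeC (proj₂ (O p)) ≟ codeC y
    ... | yes eq = proj₂ (covers p (codeC-injective eq))
    ... | no  ≢  = contradiction (cong codeC p∈) ≢

    simulation : StreamingAlgorithm Ω 𝒪 s
    simulation = record
      { Q   = Fin (2 ^ s)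
      ; ∣Q∣ = ↔-refl
      ; q₀  = enc (q₀ , y)
      ; δ   = λ j ω → enc (δ (dec j) ω)
      ; O   = proj₁ ∘ O ∘ dec
      }

    module B = StreamingAlgorithm simulation

    -- The hypothesis, that every continuation from `p` restores `y`, puts `p` itself in the class
    -- (take the empty stream) and passes to each successor of `p`, so induction on the stream goes
    -- through.
    simulates : ∀ p → (∀ S → proj₂ (O (Δ δ p S)) ≡ y) → ∀ S → dec (Δ B.δ (enc p) S) ≡ Δ δ p S
    simulates p safe []      = dec-enc p (safe [])
    simulates p safe (ω ∷ S) rewrite dec-enc p (safe []) =
      simulates (δ p ω) (λ S′ → safe (ω ∷ S′)) S

    simulation-output : ∀ S → B.output S ≡ output y S
    simulation-output S = cong (proj₁ ∘ O) (simulates (q₀ , y) (λ S′ → restores S′ y) S)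

theorem40 : ∀ {a b : Level} {Ω : Set a} {𝒪 : Set b} (s c : ℕ)
    (A : CatalyticStreamingAlgorithm Ω 𝒪 s c) →
    Σ[ B ∈ StreamingAlgorithm Ω 𝒪 s ]
    (∀ (S : Stream Ω) (y : CatalyticStreamingAlgorithm.C A) →
    StreamingAlgorithm.output B S ≡ CatalyticStreamingAlgorithm.output A y S)
-- The simulation follows the run from the single state `y₀`; `independent` transfers its output to
-- every `y`.
theorem40 s c A with y₀ , dec , covers ← small-restoring-class A =
  simulation , λ S y → trans (simulation-output S) (CatalyticStreamingAlgorithm.independent A S y₀ y)
  where open Simulation A y₀ dec covers
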